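{- Let $k\ge 1$ and $n\ge 0$ be integers. The $(k+1)$-tuple of statistics $(\mathrm{pk}_0,\mathrm{pk}_1,\dots,\mathrm{pk}_{k-1},\mathrm{dd})$ on the set $\mathcal{P}^k_n$ of $k$-Dyck paths of down-size $n$ is jointly equidistributed with any of its permutations. That is, writing $(s_0,\dots,s_{k})=(\mathrm{pk}_0,\dots,\mathrm{pk}_{k-1},\mathrm{dd})$, for every permutation $\sigma$ of $\{0,1,\dots,k\}$ and all nonnegative integers $r_0,\dots,r_k$, the number of $P\in\mathcal{P}^k_n$ with $s_i(P)=r_i$ for all $i$ equals the number of $P\in\mathcal{P}^k_n$ with $s_{\sigma(i)}(P)=r_i$ for all $i$.
   Context: A $k$-Dyck path of down-size $n$ is a lattice path from $(0,0)$ to $((k+1)n,0)$ with steps $u=(1,1)$ (up-step) and $d=(1,-k)$ (down-step) that stays in the first quadrant (i.e. never goes below the $x$-axis). It has $n$ down-steps and $kn$ up-steps; for $n=0$ it is the one-point (empty) path. $\mathcal{P}^k_n$ is the set of all such paths. A peak is a block of two consecutive steps $ud$; its height is the second coordinate of the left endpoint of its $d$ step. A double descent is a block of two consecutive steps $dd$. For $0\le i\le k-1$, $\mathrm{pk}_i(P)$ is the number of non-rightmost peaks of $P$ (all peaks except the last one in the path) whose height is congruent to $i$ modulo $k$; $\mathrm{dd}(P)$ is the number of double descents of $P$. All statistics are $0$ on the empty path. -}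

module Defs where

open import Data.Fin.Base using (Fin; toℕ)
open import Data.List.Base using (List; []; _∷_; drop; filter; length)
open import Data.Maybe.Base using (Maybe; just; nothing)
open import Data.Nat.Base using (ℕ; zero; suc; _+_; _*_; _%_; NonZero)
open import Data.Nat.Properties using (_≟_)
open import Data.Product.Base using (∃-syntax; _×_)
open import Data.Vec.Base using (lookup; tabulate; _∷ʳ_)
open import Function.Bundles using (_↔_)

data Step : Set where
  u d : Step

private
  variable
    k x y : ℕ

-- Path k x y: lattice paths from (0,0) to (x,y) with steps u = (1,1) and
-- d = (1,-k), built by appending steps on the right.  Every vertex has
-- natural-number coordinates, so the path never leaves the first quadrant.
data Path (k : ℕ) : ℕ → ℕ → Set where
  start : Path k 0 0
  _▸u   : Path k x y → Path k (suc x) (suc y)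
  _▸d   : Path k x (k + y) → Path k (suc x) y

DyckPath : ℕ → ℕ → Set
DyckPath k n = Path k (suc k * n) 0

lastStep : Path k x y → Maybe Step
lastStep start  = nothing
lastStep (p ▸u) = just u
lastStep (p ▸d) = just d

-- Heights of all peaks, listed from right to left; `k + y` is the height of
-- the left endpoint of the d step.
peakHeights : Path k x y → List ℕ
peakHeights start = []
peakHeights (p ▸u) = peakHeights p
peakHeights {k} {y = y} (p ▸d) with lastStep p
... | just u  = (k + y) ∷ peakHeights p
... | just d  = peakHeights p
... | nothing = peakHeights p

-- `drop 1` removes the rightmost peak, which is listed first.
pk : .{{_ : NonZero k}} → Fin k → Path k x y → ℕ
pk {k} i p = length (filter (λ h → h % k ≟ toℕ i) (drop 1 (peakHeights p)))

dd : Path k x y → ℕ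
dd start = 0
dd (p ▸u) = dd p
dd (p ▸d) with lastStep p
... | just d  = suc (dd p)
... | just u  = dd p
... | nothing = dd p

-- The tuple (pk₀ , … , pkₖ₋₁ , dd), indexed by 0 , … , k.
stat : .{{_ : NonZero k}} → Path k x y → Fin (suc k) → ℕ
stat p = lookup (tabulate (λ i → pk i p) ∷ʳ dd p)

-- A and B are finite with the same number of elements.
SameNumber : Set → Set → Set
SameNumber A B = ∃[ N ] (A ↔ Fin N) × (B ↔ Fin N)

{-# OPTIONS --safe #-}
module Submission where

-- Cutting a nonempty path P at its last d step and at the last visits to the
-- heights 0, ..., k - 1 before it gives P = P_0 u P_1 u ... u P_k d with
-- k + 1 smaller Dyck paths, so Dyck paths of down-size n are (k+1)-ary trees
-- with n nodes, the i-th subtree lying at height i above its node.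
--
-- The statistics count the edges of the tree.  The last d step of P makes a
-- double descent exactly when P_k is nonempty.  For j < k, a nonempty P_j
-- starts and ends at height j and ends in u d ... d, so its rightmost peak
-- has height congruent to j modulo k; in P it is a non-rightmost peak.  The
-- rightmost peak of P_k, if there is one, is the rightmost peak of P.  By
-- induction, label the edge from a node at height h to its j-th child by the
-- residue of h + j modulo k if j < k, and by k if j = k.  Then the l-th
-- statistic is the number of edges labelled l (stat-edgeWeight).
--
-- At every node the k + 1 labels are a permutation of 0, ..., k.  Hence
-- applying σ to all labels is a bijection on trees: at each node, move the
-- child whose edge has label l to the slot with label σ l, and continue in
-- the moved child, which may now lie at another height.  Both heights are
-- carried along in the recursion (relabel).  The inverse is the same
-- operation for the inverse of σ, and the number of nodes is preserved.  Read
-- back on paths, the bijection carries the l-th statistic to the (σ l)-th.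

open import Data.Bool.Base using (if_then_else_)
open import Data.Empty.Irrelevant using (⊥-elim)
open import Data.Fin.Base
  using (Fin; zero; suc; toℕ; fromℕ; inject₁; opposite; punchIn; _↑ˡ_; _↑ʳ_)
open import Data.Fin.Permutation
  using (Permutation′; _⟨$⟩ʳ_; _⟨$⟩ˡ_; permutation; flip; reverse; insert;
    insert-punchIn; inverseˡ; inverseʳ; _∘ₚ_)
open import Data.Fin.Properties
  using (_≟_; all?; toℕ<n; toℕ-fromℕ; toℕ-fromℕ<; toℕ-injective; toℕ-inject₁;
    inject₁-injective; fromℕ≢inject₁; +↔⊎; 1↔⊤)
open import Data.Fin.Relation.Unary.Top using (view; ‵fromℕ; ‵inject₁)
open import Data.Irrelevant using ([_])
open import Data.List.Base using (List; []; _∷_; drop; filter; length)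
open import Data.List.Properties using (filter-accept; filter-reject)
open import Data.Maybe.Base using (Maybe; just; nothing)
open import Data.Nat.Base using (ℕ; zero; suc; _+_; _*_; _%_; pred; NonZero; ≢-nonZero⁻¹)
open import Data.Nat.DivMod
  using (_mod_; m%n<n; m<n⇒m%n≡m; [m+n]%n≡m%n; [m+kn]%n≡m%n; %-distribˡ-+; m%n%n≡m%n)
import Data.Nat.Properties as ℕ
open import Data.Nat.Solver using (module +-*-Solver)
open import Data.Product.Base using (∃-syntax; _×_; _,_; proj₁; proj₂)
open import Data.Refinement using (Refinement; Refinement-syntax; _,_; map)
open import Data.Sum.Base using (inj₁; inj₂)
open import Data.Sum.Function.Propositional using (_⊎-↔_)
open import Data.Unit.Base using (tt)
open import Data.Vec.Base using (Vec; []; _∷_; lookup; tabulate; _∷ʳ_)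
open import Data.Vec.Properties using (lookup∘tabulate)
open import Defs
open import Function.Base using (_∘_; id; _∋_)
open import Function.Bundles using (_↔_; mk↔ₛ′; Inverse)
open import Function.Properties.Inverse using (↔-refl; ↔-sym; ↔-trans)
open import Relation.Binary.PropositionalEquality
open import Relation.Nullary.Decidable using (Dec; yes; no; does)
open import Relation.Nullary.Negation using (contradiction)

open import Algebra.Properties.CommutativeMonoid.Sum ℕ.+-0-commutativeMonoid
  using (sum; sum-cong-≗; sum-permute)

private
  variable
    k m n x y : ℕ

-- Finite sets

-- Sorting paths by their last step; the d steps come from Path k x (k + y).
finitePaths : ∀ k x y → ∃[ N ] (Path k x y ↔ Fin N)
finitePaths k zero zero = 1 , ↔-trans
  (mk↔ₛ′ (λ _ → tt) (λ _ → start) (λ _ → refl) (λ { start → refl }))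
  (↔-sym 1↔⊤)
finitePaths k zero (suc y) = 0 , mk↔ₛ′ (λ ()) (λ ()) (λ ()) (λ ())
finitePaths k (suc x) zero with finitePaths k x (k + 0)
... | N , e = N , ↔-trans (mk↔ₛ′ (λ { (p ▸d) → p }) _▸d (λ _ → refl) (λ { (p ▸d) → refl })) e
finitePaths k (suc x) (suc y) with finitePaths k x y | finitePaths k x (k + suc y)
... | M , e | N , f = M + N , ↔-trans
  (mk↔ₛ′ (λ { (p ▸u) → inj₁ p ; (p ▸d) → inj₂ p })
         (λ { (inj₁ p) → p ▸u ; (inj₂ p) → p ▸d })
         (λ { (inj₁ p) → refl ; (inj₂ p) → refl })
         (λ { (p ▸u) → refl ; (p ▸d) → refl }))
  (↔-trans (e ⊎-↔ f) (↔-sym +↔⊎))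

finiteSubset : (P : Fin n → Set) → (∀ i → Dec (P i)) → ∃[ M ] ([ i ∈ Fin n ∣ P i ] ↔ Fin M)
finiteSubset {zero} P P? = 0 , mk↔ₛ′ (λ ()) (λ ()) (λ ()) (λ ())
finiteSubset {suc n} P P? with finiteSubset (P ∘ suc) (P? ∘ suc) | P? zero
... | M , e | no ¬p = M , ↔-trans
  (mk↔ₛ′ (λ { (zero , [ p ]) → ⊥-elim (¬p p) ; (suc i , p) → i , p })
         (λ { (i , p) → suc i , p })
         (λ { (i , p) → refl })
         (λ { (zero , [ p ]) → ⊥-elim (¬p p) ; (suc i , p) → refl }))
  e
... | M , e | yes p₀ = 1 + M , ↔-trans
  (mk↔ₛ′ (λ { (zero , _) → inj₁ zero ; (suc i , p) → inj₂ (i , p) })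
         (λ { (inj₁ _) → zero , [ p₀ ] ; (inj₂ (i , p)) → suc i , p })
         (λ { (inj₁ zero) → refl ; (inj₂ _) → refl })
         (λ { (zero , _) → refl ; (suc i , p) → refl }))
  (↔-trans (↔-refl ⊎-↔ e) (↔-sym +↔⊎))

refinement-↔ : {A B : Set} {P : A → Set} {Q : B → Set} (e : A ↔ B) →
  (∀ {a} → P a → Q (Inverse.to e a)) → (∀ {b} → Q b → P (Inverse.from e b)) →
  [ a ∈ A ∣ P a ] ↔ [ b ∈ B ∣ Q b ]
refinement-↔ {P = P} {Q} e to from = mk↔ₛ′ (map (Inverse.to e) to) (map (Inverse.from e) from)
  (λ b → ext {P = Q} (Inverse.strictlyInverseˡ e (Refinement.value b)))
  (λ a → ext {P = P} (Inverse.strictlyInverseʳ e (Refinement.value a)))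
  where
  ext : {A : Set} {P : A → Set} {v w : [ a ∈ A ∣ P a ]} →
        Refinement.value v ≡ Refinement.value w → v ≡ w
  ext refl = refl

finiteRefinement : {A : Set} (P : A → Set) → (∀ a → Dec (P a)) →
  ∃[ N ] (A ↔ Fin N) → ∃[ M ] ([ a ∈ A ∣ P a ] ↔ Fin M)
finiteRefinement P P? (N , e) with finiteSubset (P ∘ Inverse.from e) (P? ∘ Inverse.from e)
... | M , f = M , ↔-trans
  (refinement-↔ e (λ {a} → subst P (sym (Inverse.strictlyInverseʳ e a))) id) f

-- Sums, indicators and indexing

sum-++ : (f : Fin (m + n) → ℕ) → sum f ≡ sum (f ∘ (_↑ˡ n)) + sum (f ∘ (m ↑ʳ_))
sum-++ {zero}  f = refl
sum-++ {suc m} f = trans (cong (f zero +_) (sum-++ {m} (f ∘ suc))) (sym (ℕ.+-assoc (f zero) _ _))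

-- The Kronecker delta.
δ : Fin n → Fin n → ℕ
δ l m = if does (l ≟ m) then 1 else 0

δ-≡ : {l m : Fin n} → l ≡ m → δ l m ≡ 1
δ-≡ {l = l} {m = m} l≡m with l ≟ m
... | yes _   = refl
... | no  l≢m = contradiction l≡m l≢m

δ-refl : (l : Fin n) → δ l l ≡ 1
δ-refl l = δ-≡ {l = l} refl

δ-≢ : {l m : Fin n} → l ≢ m → δ l m ≡ 0
δ-≢ {l = l} {m = m} l≢m with l ≟ m
... | yes l≡m = contradiction l≡m l≢m
... | no  _   = refl

δ-permute : ∀ (σ : Permutation′ n) l m → δ (σ ⟨$⟩ʳ l) (σ ⟨$⟩ʳ m) ≡ δ l m
δ-permute σ l m with l ≟ m
... | yes refl = δ-refl (σ ⟨$⟩ʳ l)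
... | no  l≢m  = δ-≢ {l = σ ⟨$⟩ʳ l} {m = σ ⟨$⟩ʳ m} λ eq →
      l≢m (trans (sym (inverseˡ σ)) (trans (cong (σ ⟨$⟩ˡ_) eq) (inverseˡ σ)))

punchIn-fromℕ : (i : Fin n) → punchIn (fromℕ n) i ≡ inject₁ i
punchIn-fromℕ zero    = refl
punchIn-fromℕ (suc i) = cong suc (punchIn-fromℕ i)

lookup-∷ʳ-fromℕ : {A : Set} (v : Vec A n) (a : A) → lookup (v ∷ʳ a) (fromℕ n) ≡ a
lookup-∷ʳ-fromℕ []      a = refl
lookup-∷ʳ-fromℕ (_ ∷ v) a = lookup-∷ʳ-fromℕ v a

lookup-∷ʳ-inject₁ : {A : Set} (v : Vec A n) (a : A) (i : Fin n) → lookup (v ∷ʳ a) (inject₁ i) ≡ lookup v i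
lookup-∷ʳ-inject₁ (_ ∷ v) a zero    = refl
lookup-∷ʳ-inject₁ (_ ∷ v) a (suc i) = lookup-∷ʳ-inject₁ v a i

-- Trees

-- (k+1)-ary plane trees; a leaf is an empty subtree.  The children are listed
-- from the top down: child i of a node stands for the factor P_(k-i) in
-- P_0 u P_1 u ... u P_k d.
data Tree (k : ℕ) : Set where
  leaf : Tree k
  node : (Fin (suc k) → Tree k) → Tree k

-- Extensional equality of trees, whose children are given by functions.
data _≈_ {k : ℕ} : Tree k → Tree k → Set where
  leaf : leaf ≈ leaf
  node : ∀ {f g} → (∀ i → f i ≈ g i) → node f ≈ node g

≈-refl : {t : Tree k} → t ≈ t
≈-refl {t = leaf}   = leaf
≈-refl {t = node f} = node λ i → ≈-refl

≈-trans : {s t r : Tree k} → s ≈ t → t ≈ r → s ≈ r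
≈-trans leaf     leaf     = leaf
≈-trans (node p) (node q) = node λ i → ≈-trans (p i) (q i)

-- Paths as stacks of trees

-- A path ending at height y factors uniquely as Q_0 u Q_1 u ... u Q_y with
-- Dyck paths Q_i, and is read as a stack of y + 1 trees, the top one (index
-- zero) for Q_y.  A u step pushes an empty tree; a d step pops the topmost
-- k + 1 trees and pushes the node having them as children.
parse : Path k x y → Fin (suc y) → Tree k
parse start _ = leaf
parse (p ▸u) zero    = leaf
parse (p ▸u) (suc i) = parse p i
parse (_▸d {y = y} p) zero = node λ i → parse p (i ↑ˡ y)
parse {k} (p ▸d) (suc i) = parse p (suc k ↑ʳ i)

-- Paths of arbitrary length ending at height y.
AnyPath : ℕ → ℕ → Set
AnyPath k y = ∃[ x ] Path k x y

up : AnyPath k y → AnyPath k (suc y)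
up (_ , p) = _ , p ▸u

down : AnyPath k (k + y) → AnyPath k y
down (_ , p) = _ , p ▸d

-- Operations that extend a path on the right without changing its final
-- height, such as appending a Dyck path.
Appender : ℕ → Set
Appender k = ∀ {y} → AnyPath k y → AnyPath k y

-- chain e p is p followed by e n, u, e (n-1), u, ..., u, e 0: the highest
-- factor has index zero.
chain : (Fin (suc n) → Appender k) → AnyPath k y → AnyPath k (n + y)
chain {zero}  e p = e zero p
chain {suc n} e p = e zero (up (chain (λ i → e (suc i)) p))

-- emit t appends the Dyck path encoded by t.
emit : Tree k → Appender k
emit leaf     p = p
emit (node f) p = down (chain (λ i → emit (f i)) p)

-- build s is the path with stack s; foundation s is the path with a leaf on
-- top of the trees s.
mutual
  foundation : (Fin y → Tree k) → AnyPath k y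
  foundation {zero}  s = _ , start
  foundation {suc y} s = up (build s)

  build : (Fin (suc y) → Tree k) → AnyPath k y
  build s = emit (s zero) (foundation (s ∘ suc))

chain-cong : {e e′ : Fin (suc n) → Appender k} →
  (∀ i {y} (p : AnyPath k y) → e i p ≡ e′ i p) →
  (p : AnyPath k y) → chain e p ≡ chain e′ p
chain-cong {zero}  eq p = eq zero p
chain-cong {suc n} {e = e} eq p =
  trans (cong (λ q → e zero (up q)) (chain-cong (λ i → eq (suc i)) p)) (eq zero _)

emit-cong : {s t : Tree k} → s ≈ t → (p : AnyPath k y) → emit s p ≡ emit t p
emit-cong leaf     p = refl
emit-cong (node q) p = cong down (chain-cong (λ i → emit-cong (q i)) p)

-- The topmost n + 1 factors of a built path are appended to the foundation
-- made of the remaining ones.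
build-++ : ∀ {k} n (s : Fin (suc n + y) → Tree k) →
  build s ≡ chain (λ i → emit (s (i ↑ˡ y))) (foundation (λ i → s (suc n ↑ʳ i)))
build-++ zero    s = refl
build-++ (suc n) s = cong (λ q → emit (s zero) (up q)) (build-++ n (s ∘ suc))

build-parse : (p : Path k x y) → build (parse p) ≡ (x , p)
build-parse start  = refl
build-parse (p ▸u) = cong up (build-parse p)
build-parse {k} (p ▸d) = cong down (trans (sym (build-++ k (parse p))) (build-parse p))

-- The operation e, applied to a path with a leaf on top of its stack, replaces
-- that leaf by t and leaves the rest of the stack alone.
Parses : (AnyPath k y → AnyPath k y) → Tree k → Set
Parses {k} {y} e t = ∀ (p : AnyPath k y) → parse (proj₂ p) zero ≈ leaf →
  parse (proj₂ (e p)) zero ≈ t × (∀ i → parse (proj₂ (e p)) (suc i) ≈ parse (proj₂ p) (suc i))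

parse-chain : ∀ n {e : Fin (suc n) → Appender k} {f : Fin (suc n) → Tree k} →
  (∀ i {y} → Parses {y = y} (e i) (f i)) →
  (p : AnyPath k y) → parse (proj₂ p) zero ≈ leaf →
  (∀ i → parse (proj₂ (chain e p)) (i ↑ˡ y) ≈ f i) ×
  (∀ i → parse (proj₂ (chain e p)) (suc n ↑ʳ i) ≈ parse (proj₂ p) (suc i))
parse-chain zero h p top with h zero p top
... | q , r = (λ { zero → q }) , r
parse-chain (suc n) {e} h p top
  with parse-chain n (λ i → h (suc i)) p top | h zero (up (chain (λ i → e (suc i)) p)) leaf
... | a , b | q , r = (λ { zero → q ; (suc i) → ≈-trans (r _) (a i) }) , (λ i → ≈-trans (r _) (b i))

parse-emit : (t : Tree k) → Parses {y = y} (emit t) t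
parse-emit leaf p top = top , λ i → ≈-refl
parse-emit {k} (node f) p top with parse-chain k (λ i → parse-emit (f i)) p top
... | a , b = node a , b

-- Heights and edge labels

-- The starting height of the factor with index i (counted from the top) among
-- n consecutive factors the lowest of which starts at height h.
baseHeight : ℕ → Fin n → ℕ
baseHeight {suc n} h zero    = h + n
baseHeight {suc n} h (suc i) = baseHeight h i

baseHeight-opposite : ∀ h (i : Fin n) → baseHeight h i ≡ h + toℕ (opposite i)
baseHeight-opposite {suc n} h zero    = cong (h +_) (sym (toℕ-fromℕ n))
baseHeight-opposite {suc n} h (suc i) =
  trans (baseHeight-opposite h i) (cong (h +_) (sym (toℕ-inject₁ (opposite i))))

baseHeight-↑ˡ : ∀ (i : Fin n) y → baseHeight 0 (i ↑ˡ y) ≡ baseHeight y i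
baseHeight-↑ˡ {suc n} zero    y = ℕ.+-comm n y
baseHeight-↑ˡ {suc n} (suc i) y = baseHeight-↑ˡ i y

baseHeight-↑ʳ : ∀ m h (i : Fin n) → baseHeight h (m ↑ʳ i) ≡ baseHeight h i
baseHeight-↑ʳ zero    h i = refl
baseHeight-↑ʳ (suc m) h i = baseHeight-↑ʳ m h i

toℕ-mod : ∀ m n .{{_ : NonZero n}} → toℕ (m mod n) ≡ m % n
toℕ-mod m n = toℕ-fromℕ< (m%n<n m n)

mod-cong : ∀ {m n} k .{{_ : NonZero k}} → m % k ≡ n % k → m mod k ≡ n mod k
mod-cong {m} {n} k eq = toℕ-injective (trans (toℕ-mod m k) (trans eq (sym (toℕ-mod n k))))

-- Addition of a modulo k.
rotate : ∀ k .{{_ : NonZero k}} → ℕ → Fin k → Fin k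
rotate k a i = (a + toℕ i) mod k

toℕ-rotate : ∀ k .{{_ : NonZero k}} a i → toℕ (rotate k a i) ≡ (a + toℕ i) % k
toℕ-rotate k a i = toℕ-mod (a + toℕ i) k

rotate-rotate : ∀ k .{{_ : NonZero k}} a b c → a + b ≡ c * k → ∀ i → rotate k a (rotate k b i) ≡ i
rotate-rotate k a b c eq i = toℕ-injective (begin
  toℕ (rotate k a (rotate k b i))      ≡⟨ toℕ-rotate k a (rotate k b i) ⟩
  (a + toℕ (rotate k b i)) % k         ≡⟨ cong (λ j → (a + j) % k) (toℕ-rotate k b i) ⟩
  (a + (b + toℕ i) % k) % k            ≡⟨ %-distribˡ-+ a ((b + toℕ i) % k) k ⟩
  (a % k + (b + toℕ i) % k % k) % k    ≡⟨ cong (λ j → (a % k + j) % k) (m%n%n≡m%n (b + toℕ i) k) ⟩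
  (a % k + (b + toℕ i) % k) % k        ≡⟨ %-distribˡ-+ a (b + toℕ i) k ⟨
  (a + (b + toℕ i)) % k                ≡⟨ cong (_% k) (ℕ.+-assoc a b (toℕ i)) ⟨
  (a + b + toℕ i) % k                  ≡⟨ cong (λ j → (j + toℕ i) % k) eq ⟩
  (c * k + toℕ i) % k                  ≡⟨ cong (_% k) (ℕ.+-comm (c * k) (toℕ i)) ⟩
  (toℕ i + c * k) % k                  ≡⟨ [m+kn]%n≡m%n (toℕ i) c k ⟩
  toℕ i % k                            ≡⟨ m<n⇒m%n≡m (toℕ<n i) ⟩
  toℕ i                                ∎)
  where open ≡-Reasoning

-- Rotation by h; its inverse adds h * (k - 1), which is congruent to - h.
rotation : ∀ k .{{_ : NonZero k}} → ℕ → Permutation′ k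
rotation k h = permutation (rotate k h) (rotate k (h * pred k))
  (rotate-rotate k h (h * pred k) h h+h*pred[k]≡h*k)
  (rotate-rotate k (h * pred k) h h (trans (ℕ.+-comm (h * pred k) h) h+h*pred[k]≡h*k))
  where
  h+h*pred[k]≡h*k : h + h * pred k ≡ h * k
  h+h*pred[k]≡h*k = trans (sym (ℕ.*-suc h (pred k))) (cong (h *_) (ℕ.suc-pred k))

-- The index in the tuple of statistics of the peaks of height h; the index of
-- the double descents is fromℕ k.
peakLabel : ∀ k .{{_ : NonZero k}} → ℕ → Fin (suc k)
peakLabel k h = inject₁ (h mod k)

peakLabel-+k : ∀ k .{{_ : NonZero k}} h → peakLabel k (h + k) ≡ peakLabel k h
peakLabel-+k k h = cong inject₁ (mod-cong k ([m+n]%n≡m%n h k))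

peakLabel-k+ : ∀ k .{{_ : NonZero k}} h → peakLabel k (k + h) ≡ peakLabel k h
peakLabel-k+ k h = trans (cong (peakLabel k) (ℕ.+-comm k h)) (peakLabel-+k k h)

-- The label of the edge from a node starting at height h to its child i: the
-- double descents for the top child, and otherwise the residue of the starting
-- height of the child.  The starting heights h, ..., h + k - 1 of the other
-- children represent each residue once, so this is a permutation.  It is
-- opaque because only its two characteristic equations are needed, and
-- unfolding it is costly.
opaque
  edgeLabel : ∀ k .{{_ : NonZero k}} → ℕ → Permutation′ (suc k)
  edgeLabel k h = insert zero (fromℕ k) (reverse ∘ₚ rotation k h)

  edgeLabel-zero : ∀ k .{{_ : NonZero k}} h → edgeLabel k h ⟨$⟩ʳ zero ≡ fromℕ k
  edgeLabel-zero k h = refl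

  edgeLabel-suc : ∀ k .{{_ : NonZero k}} h i →
    edgeLabel k h ⟨$⟩ʳ suc i ≡ peakLabel k (baseHeight h i)
  edgeLabel-suc k h i = begin
    edgeLabel k h ⟨$⟩ʳ suc i
      ≡⟨ insert-punchIn zero (fromℕ k) (reverse ∘ₚ rotation k h) i ⟩
    punchIn (fromℕ k) (rotate k h (opposite i))  ≡⟨ punchIn-fromℕ (rotate k h (opposite i)) ⟩
    peakLabel k (h + toℕ (opposite i))           ≡⟨ cong (peakLabel k) (baseHeight-opposite h i) ⟨
    peakLabel k (baseHeight h i)                 ∎
    where open ≡-Reasoning

-- Relabelling trees

module _ {k : ℕ} .{{_ : NonZero k}} where

  -- When a node at height h is relabelled by σ and moved to height h′, the child
  -- in slot j of the result comes from slot source σ h h′ j: the labels of the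
  -- two slots correspond under σ.
  source : Permutation′ (suc k) → ℕ → ℕ → Permutation′ (suc k)
  source σ h h′ = edgeLabel k h′ ∘ₚ flip σ ∘ₚ flip (edgeLabel k h)

  -- Applies σ to all edge labels of a tree; h and h′ are the starting heights of
  -- the given and of the resulting tree.
  relabel : Permutation′ (suc k) → ℕ → ℕ → Tree k → Tree k
  relabel σ h h′ leaf     = leaf
  relabel σ h h′ (node f) = node λ j → let i = source σ h h′ ⟨$⟩ʳ j in
    relabel σ (baseHeight h i) (baseHeight h′ j) (f i)

  relabel-cong : ∀ σ h h′ {s t} → s ≈ t → relabel σ h h′ s ≈ relabel σ h h′ t
  relabel-cong σ h h′ leaf     = leaf
  relabel-cong σ h h′ (node p) = node λ j → relabel-cong σ _ _ (p _)

  relabel-inverse : ∀ σ h h′ t → relabel (flip σ) h′ h (relabel σ h h′ t) ≈ t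
  relabel-inverse σ h h′ leaf     = leaf
  relabel-inverse σ h h′ (node f) = node λ i →
    let j = source (flip σ) h′ h ⟨$⟩ʳ i in subst
    (λ i′ → relabel (flip σ) (baseHeight h′ j) (baseHeight h i)
              (relabel σ (baseHeight h i′) (baseHeight h′ j) (f i′)) ≈ f i)
    (sym (inverseʳ (source σ h h′)))
    (relabel-inverse σ (baseHeight h i) (baseHeight h′ j) (f i))

  -- mark t v is v if t is nonempty and 0 otherwise.
  mark : Tree k → ℕ → ℕ
  mark leaf     v = 0
  mark (node _) v = v

  mark-0 : ∀ t → mark t 0 ≡ 0
  mark-0 leaf     = refl
  mark-0 (node _) = refl

  -- The sum of w over the labels of all edges of a tree starting at height h;
  -- only edges to nonempty children count.
  edgeWeight : (Fin (suc k) → ℕ) → ℕ → Tree k → ℕ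
  edgeWeight w h leaf     = 0
  edgeWeight w h (node f) = sum λ i →
    mark (f i) (w (edgeLabel k h ⟨$⟩ʳ i)) + edgeWeight w (baseHeight h i) (f i)

  -- The same with one further edge above a nonempty tree, labelled as if the
  -- tree were a child other than the top one.
  treeWeight : (Fin (suc k) → ℕ) → ℕ → Tree k → ℕ
  treeWeight w h t = mark t (w (peakLabel k h)) + edgeWeight w h t

  mark-cong : ∀ {s t} v → s ≈ t → mark s v ≡ mark t v
  mark-cong v leaf     = refl
  mark-cong v (node _) = refl

  edgeWeight-cong : ∀ w h {s t} → s ≈ t → edgeWeight w h s ≡ edgeWeight w h t
  edgeWeight-cong w h leaf     = refl
  edgeWeight-cong w h (node p) =
    sum-cong-≗ λ i → cong₂ _+_ (mark-cong (w (edgeLabel k h ⟨$⟩ʳ i)) (p i))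
                               (edgeWeight-cong w (baseHeight h i) (p i))

  edgeWeight-≗ : ∀ {w w′ : Fin (suc k) → ℕ} → w ≗ w′ → ∀ h t → edgeWeight w h t ≡ edgeWeight w′ h t
  edgeWeight-≗ eq h leaf     = refl
  edgeWeight-≗ eq h (node f) =
    sum-cong-≗ λ i → cong₂ _+_ (cong (mark (f i)) (eq (edgeLabel k h ⟨$⟩ʳ i)))
                               (edgeWeight-≗ eq (baseHeight h i) (f i))

  mark-relabel : ∀ σ h h′ t v → mark (relabel σ h h′ t) v ≡ mark t v
  mark-relabel σ h h′ leaf     v = refl
  mark-relabel σ h h′ (node f) v = refl

  edgeLabel-source : ∀ σ h h′ j →
    edgeLabel k h′ ⟨$⟩ʳ j ≡ σ ⟨$⟩ʳ (edgeLabel k h ⟨$⟩ʳ (source σ h h′ ⟨$⟩ʳ j))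
  edgeLabel-source σ h h′ j =
    sym (trans (cong (σ ⟨$⟩ʳ_) (inverseʳ (edgeLabel k h))) (inverseʳ σ))

  edgeWeight-relabel : ∀ w σ h h′ t →
    edgeWeight w h′ (relabel σ h h′ t) ≡ edgeWeight (w ∘ (σ ⟨$⟩ʳ_)) h t
  edgeWeight-relabel w σ h h′ leaf     = refl
  edgeWeight-relabel w σ h h′ (node f) = trans
    (sum-cong-≗ λ j → let i = source σ h h′ ⟨$⟩ʳ j in cong₂ _+_
      (trans (mark-relabel σ (baseHeight h i) (baseHeight h′ j) (f i) (w (edgeLabel k h′ ⟨$⟩ʳ j)))
             (cong (λ l → mark (f i) (w l)) (edgeLabel-source σ h h′ j)))
      (edgeWeight-relabel w σ (baseHeight h i) (baseHeight h′ j) (f i)))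
    (sym (sum-permute
      (λ i → mark (f i) (w (σ ⟨$⟩ʳ (edgeLabel k h ⟨$⟩ʳ i))) +
             edgeWeight (w ∘ (σ ⟨$⟩ʳ_)) (baseHeight h i) (f i))
      (source σ h h′)))

  -- The top child f zero starts at height h + k, so in its tree weight the edge
  -- above it has label peakLabel k h; in the node this edge has label fromℕ k.
  -- The term added on the left compensates for the exchange.
  treeWeight-node : ∀ (w : Fin (suc k) → ℕ) h f →
    treeWeight w h (node f) + mark (f zero) (w (peakLabel k h)) ≡
    w (peakLabel k h) + mark (f zero) (w (fromℕ k)) + sum (λ i → treeWeight w (baseHeight h i) (f i))
  treeWeight-node w h f = begin
    treeWeight w h (node f) + c
      ≡⟨ cong₂ (λ l r → a + (mark (f zero) (w l) + e + r) + c) (edgeLabel-zero k h)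
           (sum-cong-≗ λ i → cong (λ l → mark (f (suc i)) (w l) + rest i) (edgeLabel-suc k h i)) ⟩
    a + (b + e + r) + c
      ≡⟨ solve 5 (λ a b c e r → a :+ (b :+ e :+ r) :+ c := a :+ b :+ (c :+ e :+ r)) refl a b c e r ⟩
    a + b + (c + e + r)
      ≡⟨ cong (λ l → a + b + (mark (f zero) (w l) + e + r)) (peakLabel-+k k h) ⟨
    a + b + (mark (f zero) (w (peakLabel k (h + k))) + e + r) ∎
    where
    open ≡-Reasoning
    open +-*-Solver
    rest : Fin k → ℕ
    rest i = edgeWeight w (baseHeight h i) (f (suc i))
    a b c e r : ℕ
    a = w (peakLabel k h)
    b = mark (f zero) (w (fromℕ k))
    c = mark (f zero) (w (peakLabel k h))
    e = edgeWeight w (h + k) (f zero)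
    r = sum λ i → treeWeight w (baseHeight h i) (f (suc i))

  -- Label of a d step ending at height y, given the step before it: fromℕ k if it
  -- completes a double descent, otherwise that of its peak, whose height k + y
  -- is congruent to y.  A d step is never the first step of a path, so the
  -- value at nothing is immaterial.
  downLabel : Maybe Step → ℕ → Fin (suc k)
  downLabel (just d) y = fromℕ k
  downLabel (just u) y = peakLabel k y
  downLabel nothing  y = peakLabel k y

  -- The sum of w over the labels of all d steps of a path.
  weight : (Fin (suc k) → ℕ) → Path k x y → ℕ
  weight w start  = 0
  weight w (p ▸u) = weight w p
  weight w (_▸d {y = y} p) = w (downLabel (lastStep p) y) + weight w p

  -- The stack has a nonempty tree on top exactly when the last step is d.
  downLabel-mark : ∀ (w : Fin (suc k) → ℕ) h (p : Path k x y) →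
    w (downLabel (lastStep p) h) + mark (parse p zero) (w (peakLabel k h)) ≡
    w (peakLabel k h) + mark (parse p zero) (w (fromℕ k))
  downLabel-mark w h start  = refl
  downLabel-mark w h (p ▸u) = refl
  downLabel-mark w h (p ▸d) = ℕ.+-comm (w (fromℕ k)) _

  -- The labels of the d steps are the labels of the edges in the stack, with an
  -- edge above every nonempty tree.  An appended d step keeps the edges of the
  -- stack, except that the edge above the former top tree becomes a top edge,
  -- and adds the edge above the new node.
  weight-parse : ∀ (w : Fin (suc k) → ℕ) (p : Path k x y) →
    weight w p ≡ sum λ i → treeWeight w (baseHeight 0 i) (parse p i)
  weight-parse w start  = refl
  weight-parse w (p ▸u) = weight-parse w p
  weight-parse w (_▸d {y = y} p) = ℕ.+-cancelʳ-≡ c _ _ (begin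
    w l + weight w p + c
      ≡⟨ cong (λ v → w l + v + c) (trans (weight-parse w p)
           (sum-++ {suc k} (λ i → treeWeight w (baseHeight 0 i) (parse p i)))) ⟩
    w l + (sum (λ i → treeWeight w (baseHeight 0 (i ↑ˡ y)) (f i)) +
           sum (λ i → treeWeight w (baseHeight 0 (suc k ↑ʳ i)) (g i))) + c
      ≡⟨ cong₂ (λ s t → w l + (s + t) + c)
           (sum-cong-≗ λ i → cong (λ h → treeWeight w h (f i)) (baseHeight-↑ˡ i y))
           (sum-cong-≗ λ i → cong (λ h → treeWeight w h (g i)) (baseHeight-↑ʳ (suc k) 0 i)) ⟩
    w l + (S + T) + c
      ≡⟨ solve 4 (λ a s t c → a :+ (s :+ t) :+ c := a :+ c :+ s :+ t) refl (w l) S T c ⟩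
    w l + c + S + T
      ≡⟨ cong (λ v → v + S + T) (downLabel-mark w y p) ⟩
    w (peakLabel k y) + mark (f zero) (w (fromℕ k)) + S + T
      ≡⟨ cong (_+ T) (treeWeight-node w y f) ⟨
    treeWeight w y (node f) + c + T
      ≡⟨ solve 3 (λ a c t → a :+ c :+ t := a :+ t :+ c) refl (treeWeight w y (node f)) c T ⟩
    treeWeight w y (node f) + T + c ∎)
    where
    open ≡-Reasoning
    open +-*-Solver
    l = downLabel (lastStep p) y
    f : Fin (suc k) → Tree k
    f i = parse p (i ↑ˡ y)
    g : Fin y → Tree k
    g i = parse p (suc k ↑ʳ i)
    c S T : ℕ
    c = mark (f zero) (w (peakLabel k y))
    S = sum λ i → treeWeight w (baseHeight y i) (f i)
    T = sum λ i → treeWeight w (baseHeight 0 i) (g i)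

  -- With w = 1 the weight counts d steps, and these determine the length.
  length-weight : (p : Path k x y) → x ≡ y + suc k * weight (λ _ → 1) p
  length-weight start  = sym (ℕ.*-zeroʳ k)
  length-weight (p ▸u) = cong suc (length-weight p)
  length-weight {y = y} (p ▸d) = trans (cong suc (length-weight p))
    (solve 3 (λ k y v → con 1 :+ (k :+ y :+ (con 1 :+ k) :* v) := y :+ (con 1 :+ k) :* (con 1 :+ v))
       refl k y (weight (λ _ → 1) p))
    where open +-*-Solver

  -- Statistics as edge counts

  weight-dd : (p : Path k x y) → weight (δ (fromℕ k)) p ≡ dd p
  weight-dd start  = refl
  weight-dd (p ▸u) = weight-dd p
  weight-dd (p ▸d) with lastStep p
  ... | just d  = cong₂ _+_ (δ-refl (fromℕ k)) (weight-dd p)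
  ... | just u  = cong₂ _+_ (δ-≢ {l = fromℕ k} {m = peakLabel k _} fromℕ≢inject₁) (weight-dd p)
  ... | nothing = cong₂ _+_ (δ-≢ {l = fromℕ k} {m = peakLabel k _} fromℕ≢inject₁) (weight-dd p)

  -- The number of heights in hs congruent to i modulo k.
  count : Fin k → List ℕ → ℕ
  count i hs = length (filter (λ h → h % k ℕ.≟ toℕ i) hs)

  count-∷ : ∀ i h hs → count i (h ∷ hs) ≡ δ (inject₁ i) (peakLabel k h) + count i hs
  count-∷ i h hs = split (P? h)
    where
    open ≡-Reasoning
    P? : ∀ h → Dec (h % k ≡ toℕ i)
    P? h = h % k ℕ.≟ toℕ i
    hit : h % k ≡ toℕ i → inject₁ i ≡ peakLabel k h
    hit eq = cong inject₁ (toℕ-injective (trans (sym eq) (sym (toℕ-mod h k))))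
    miss : h % k ≢ toℕ i → inject₁ i ≢ peakLabel k h
    miss neq eq = neq (trans (sym (toℕ-mod h k)) (cong toℕ (sym (inject₁-injective eq))))
    split : Dec (h % k ≡ toℕ i) → count i (h ∷ hs) ≡ δ (inject₁ i) (peakLabel k h) + count i hs
    split (yes eq) = begin
      count i (h ∷ hs)                            ≡⟨ cong length (filter-accept P? {h} {hs} eq) ⟩
      1 + count i hs                              ≡⟨ cong (_+ count i hs) (δ-≡ (hit eq)) ⟨
      δ (inject₁ i) (peakLabel k h) + count i hs  ∎
    split (no neq) = begin
      count i (h ∷ hs)                            ≡⟨ cong length (filter-reject P? {h} {hs} neq) ⟩
      0 + count i hs                              ≡⟨ cong (_+ count i hs) (δ-≢ (miss neq)) ⟨
      δ (inject₁ i) (peakLabel k h) + count i hs  ∎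

  count-head : ∀ i h hs → count i (k + h ∷ hs) ≡ δ (inject₁ i) (peakLabel k h) + count i hs
  count-head i h hs =
    trans (count-∷ i (k + h) hs) (cong (λ l → δ (inject₁ i) l + count i hs) (peakLabel-k+ k h))

  lastStep≢nothing : (p : Path k x (k + y)) → lastStep p ≢ nothing
  lastStep≢nothing p eq = ≢-nonZero⁻¹ k (ℕ.m+n≡0⇒m≡0 k (height p eq))
    where
    height : ∀ {x y} (p : Path k x y) → lastStep p ≡ nothing → y ≡ 0
    height start _ = refl

  weight-peaks : ∀ i (p : Path k x y) → weight (δ (inject₁ i)) p ≡ count i (peakHeights p)
  weight-peaks i start  = refl
  weight-peaks i (p ▸u) = weight-peaks i p
  weight-peaks i (_▸d {y = y} p) with lastStep p in eq
  ... | just d  = cong₂ _+_ (δ-≢ {l = inject₁ i} {m = fromℕ k} (fromℕ≢inject₁ ∘ sym)) (weight-peaks i p)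
  ... | just u  = trans (cong (_ +_) (weight-peaks i p)) (sym (count-head i y _))
  ... | nothing = contradiction eq (lastStep≢nothing p)

  -- The rightmost peak is followed by d steps only, so its height is congruent
  -- modulo k to the final height y.
  rightmost-peak : ∀ i (p : Path k x y) → lastStep p ≡ just d →
    count i (peakHeights p) ≡ δ (inject₁ i) (peakLabel k y) + count i (drop 1 (peakHeights p))
  rightmost-peak {y = y} i (p ▸d) _ with lastStep p in eq
  ... | just u  = count-head i y _
  ... | just d  = trans (rightmost-peak i p eq)
                    (cong (λ l → δ (inject₁ i) l + count i (drop 1 (peakHeights p))) (peakLabel-k+ k y))
  ... | nothing = contradiction eq (lastStep≢nothing p)

  weight-Dyck : ∀ w (p : Path k x 0) → weight w p ≡ treeWeight w 0 (parse p zero)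
  weight-Dyck w p = trans (weight-parse w p) (ℕ.+-identityʳ _)

  -- In a nonempty Dyck path the rightmost peak has height congruent to 0, which
  -- is the label of the edge above the whole tree: both are left out.
  pk-edgeWeight : ∀ i (p : Path k x 0) → pk i p ≡ edgeWeight (δ (inject₁ i)) 0 (parse p zero)
  pk-edgeWeight i start = refl
  pk-edgeWeight i q@(_ ▸d) = ℕ.+-cancelˡ-≡ (δ (inject₁ i) (peakLabel k 0)) _ _ (begin
    δ (inject₁ i) (peakLabel k 0) + pk i q        ≡⟨ rightmost-peak i q refl ⟨
    count i (peakHeights q)                       ≡⟨ weight-peaks i q ⟨
    weight (δ (inject₁ i)) q                      ≡⟨ weight-Dyck (δ (inject₁ i)) q ⟩
    treeWeight (δ (inject₁ i)) 0 (parse q zero)   ∎)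
    where open ≡-Reasoning

  stat-edgeWeight : ∀ l (p : Path k x 0) → stat p l ≡ edgeWeight (δ l) 0 (parse p zero)
  stat-edgeWeight l p with view l
  ... | ‵fromℕ = begin
    stat p (fromℕ k)                          ≡⟨ lookup-∷ʳ-fromℕ (tabulate (λ i → pk i p)) (dd p) ⟩
    dd p                                      ≡⟨ weight-dd p ⟨
    weight (δ (fromℕ k)) p                    ≡⟨ weight-Dyck (δ (fromℕ k)) p ⟩
    treeWeight (δ (fromℕ k)) 0 t              ≡⟨ cong (λ v → mark t v + edgeWeight (δ (fromℕ k)) 0 t)
                                                   (δ-≢ {l = fromℕ k} {m = peakLabel k 0} fromℕ≢inject₁) ⟩
    mark t 0 + edgeWeight (δ (fromℕ k)) 0 t   ≡⟨ cong (_+ edgeWeight (δ (fromℕ k)) 0 t) (mark-0 t) ⟩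
    edgeWeight (δ (fromℕ k)) 0 t              ∎
    where
    open ≡-Reasoning
    t = parse p zero
  ... | ‵inject₁ i = trans
    (trans (lookup-∷ʳ-inject₁ (tabulate (λ i → pk i p)) (dd p) i) (lookup∘tabulate (λ i → pk i p) i))
    (pk-edgeWeight i p)

  -- The bijection on Dyck paths

  -- Relabelling transported to Dyck paths.
  transform : Permutation′ (suc k) → AnyPath k 0 → AnyPath k 0
  transform σ (_ , p) = emit (relabel σ 0 0 (parse p zero)) (_ , start)

  parse-transform : ∀ σ (P : AnyPath k 0) →
    parse (proj₂ (transform σ P)) zero ≈ relabel σ 0 0 (parse (proj₂ P) zero)
  parse-transform σ (_ , p) = proj₁ (parse-emit (relabel σ 0 0 (parse p zero)) (_ , start) leaf)

  transform-inverse : ∀ σ P → transform (flip σ) (transform σ P) ≡ P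
  transform-inverse σ P@(_ , p) = trans
    (emit-cong (≈-trans (relabel-cong (flip σ) 0 0 (parse-transform σ P))
                        (relabel-inverse σ 0 0 (parse p zero))) _)
    (build-parse p)

  transform-length : ∀ σ P → proj₁ (transform σ P) ≡ proj₁ P
  transform-length σ P@(x , p) = begin
    x′                                         ≡⟨ length-weight p′ ⟩
    suc k * weight one p′                      ≡⟨ cong (suc k *_) (weight-Dyck one p′) ⟩
    suc k * treeWeight one 0 (parse p′ zero)   ≡⟨ cong (suc k *_) (cong₂ _+_
        (trans (mark-cong 1 (parse-transform σ P)) (mark-relabel σ 0 0 (parse p zero) 1))
        (trans (edgeWeight-cong one 0 (parse-transform σ P))
               (edgeWeight-relabel one σ 0 0 (parse p zero)))) ⟩
    suc k * treeWeight one 0 (parse p zero)    ≡⟨ cong (suc k *_) (weight-Dyck one p) ⟨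
    suc k * weight one p                       ≡⟨ length-weight p ⟨
    x                                          ∎
    where
    open ≡-Reasoning
    one : Fin (suc k) → ℕ
    one _ = 1
    x′ = proj₁ (transform σ P)
    p′ = proj₂ (transform σ P)

  stat-transform : ∀ σ P l → stat (proj₂ (transform σ P)) (σ ⟨$⟩ʳ l) ≡ stat (proj₂ P) l
  stat-transform σ P@(_ , p) l = begin
    stat p′ (σ ⟨$⟩ʳ l)                                          ≡⟨ stat-edgeWeight (σ ⟨$⟩ʳ l) p′ ⟩
    edgeWeight (δ (σ ⟨$⟩ʳ l)) 0 (parse p′ zero)                 ≡⟨ edgeWeight-cong _ 0 (parse-transform σ P) ⟩
    edgeWeight (δ (σ ⟨$⟩ʳ l)) 0 (relabel σ 0 0 (parse p zero))  ≡⟨ edgeWeight-relabel _ σ 0 0 (parse p zero) ⟩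
    edgeWeight (δ (σ ⟨$⟩ʳ l) ∘ (σ ⟨$⟩ʳ_)) 0 (parse p zero)      ≡⟨ edgeWeight-≗ (δ-permute σ l) 0 (parse p zero) ⟩
    edgeWeight (δ l) 0 (parse p zero)                           ≡⟨ stat-edgeWeight l p ⟨
    stat p l                                                    ∎
    where
    open ≡-Reasoning
    p′ = proj₂ (transform σ P)

  -- transform preserves the length only propositionally; resize moves its result
  -- into the type of paths of the original length.
  resize : (P : AnyPath k y) → proj₁ P ≡ x → Path k x y
  resize (_ , p) refl = p

  resize-≡ : (P : AnyPath k y) (eq : proj₁ P ≡ x) → (x , resize P eq) ≡ P
  resize-≡ _ refl = refl

  permuteStats : Permutation′ (suc k) → Path k x 0 → Path k x 0
  permuteStats σ p = resize (transform σ (_ , p)) (transform-length σ (_ , p))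

  permuteStats-≡ : ∀ σ (p : Path k x 0) → (x , permuteStats σ p) ≡ transform σ (x , p)
  permuteStats-≡ σ p = resize-≡ (transform σ (_ , p)) (transform-length σ (_ , p))

  permuteStats-inverse : ∀ σ (p : Path k x 0) → permuteStats (flip σ) (permuteStats σ p) ≡ p
  permuteStats-inverse σ p = ,-injʳ (begin
    (_ , permuteStats (flip σ) (permuteStats σ p))   ≡⟨ permuteStats-≡ (flip σ) (permuteStats σ p) ⟩
    transform (flip σ) (_ , permuteStats σ p)        ≡⟨ cong (transform (flip σ)) (permuteStats-≡ σ p) ⟩
    transform (flip σ) (transform σ (_ , p))         ≡⟨ transform-inverse σ (_ , p) ⟩
    (_ , p)                                          ∎)
    where
    open ≡-Reasoning
    ,-injʳ : ∀ {x y} {p q : Path k x y} → (AnyPath k y ∋ (x , p)) ≡ (x , q) → p ≡ q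
    ,-injʳ refl = refl

  stat-permuteStats : ∀ σ (p : Path k x 0) l → stat (permuteStats σ p) (σ ⟨$⟩ʳ l) ≡ stat p l
  stat-permuteStats σ p l =
    trans (cong (λ P → stat (proj₂ P) (σ ⟨$⟩ʳ l)) (permuteStats-≡ σ p)) (stat-transform σ (_ , p) l)

  permuteStats-↔ : ∀ (σ : Permutation′ (suc k)) → Path k x 0 ↔ Path k x 0
  permuteStats-↔ σ = mk↔ₛ′ (permuteStats σ) (permuteStats (flip σ))
    (permuteStats-inverse (flip σ)) (permuteStats-inverse σ)

theorem2p1 : (k : ℕ) .{{_ : NonZero k}} (n : ℕ)
    (σ : Permutation′ (suc k)) (r : Fin (suc k) → ℕ) →
    SameNumber
    [ P ∈ DyckPath k n ∣ (∀ i → stat P i ≡ r i) ]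
    [ P ∈ DyckPath k n ∣ (∀ i → stat P (σ ⟨$⟩ʳ i) ≡ r i) ]
theorem2p1 k n σ r
  with finiteRefinement (λ P → ∀ i → stat P i ≡ r i)
         (λ P → all? λ i → stat P i ℕ.≟ r i) (finitePaths k (suc k * n) 0)
... | N , e = N , e , ↔-trans (↔-sym bijection) e
  where
  bijection : [ P ∈ DyckPath k n ∣ (∀ i → stat P i ≡ r i) ] ↔
              [ P ∈ DyckPath k n ∣ (∀ i → stat P (σ ⟨$⟩ʳ i) ≡ r i) ]
  bijection = refinement-↔ (permuteStats-↔ σ)
    (λ {P} eq i → trans (stat-permuteStats σ P i) (eq i))
    (λ {P} eq i → trans
      (trans (cong (stat (permuteStats (flip σ) P)) (sym (inverseˡ σ)))
             (stat-permuteStats (flip σ) P (σ ⟨$⟩ʳ i)))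
      (eq i))
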